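{- Let $(N,t)$ be a labelled arboreal network on $X$ and $d=d_{(N,t)}$. The following are equivalent: (i) $(N,t)$ is discriminating; (ii) the assignment $\phi(v)=C(v)$ defines a bijection $\phi$ from $V(N)-X$ to $\mathcal C(K(G_d))\cup\mathcal M(d)$.
   Context: $X$ is finite with $|X|\ge2$, $M$ a non-empty set, $\odot\notin M$. In a digraph, a leaf is a vertex of indegree 1 and outdegree 0, a root is a vertex of indegree 0. A network on $X$ is a simple acyclic digraph $N$ whose underlying undirected graph is connected, whose set of leaves is $X$, in which every vertex of indegree 0 has outdegree at least 2, every vertex of outdegree 0 has indegree 1, and no vertex has both indegree and outdegree equal to 1. $N$ is arboreal if its underlying undirected graph is a tree. $v$ is an ancestor of $w$ if there is a directed path (possibly of length 0) from $v$ to $w$; $C(v)$ is the set of leaves having $v$ as ancestor. A least common ancestor of leaves $x,y$ is an ancestor of both none of whose children is an ancestor of both; in arboreal networks it is unique when $x,y$ share an ancestor, denoted $\mathrm{lca}_N(x,y)$. A labelled arboreal network $(N,t)$: $N$ arboreal network on $X$, $t$ a map from the vertices of outdegree $\ge2$ to $M$. $d_{(N,t)}:\binom X2\to M\cup\{\odot\}$ is $d_{(N,t)}(x,y)=t(\mathrm{lca}_N(x,y))$ if $x,y$ share an ancestor, $\odot$ otherwise. An internal arc is an arc neither of whose endpoints is a leaf; $(N,t)$ is discriminating if $N$ has no internal arc $(u,v)$ with $u$ of outdegree 1 and no internal arc $(u,v)$ with $v$ of indegree 1 and $t(u)=t(v)$. $G_d$ is the graph on $X$ with $x\ne y$ adjacent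 iff $d(x,y)\ne\odot$. A clique is a set of $\ge2$ pairwise adjacent vertices; $K(G)$ is the set of maximal cliques. $\mathcal C(K)=\{\bigcap_{Y\in S}Y:\emptyset\ne S\subseteq K,\ \bigcap_{Y\in S}Y\neq\emptyset\}$. A non-empty $Y\subseteq X$ is a clique-module of $d$ if $|Y|=1$, or $Y$ is a clique in $G_d$ and for all $x,y\in Y$, $z\in X-Y$: $|\{d(x,z),d(y,z),\odot\}|\le2$. It is trivial if $|Y|=1$, and strong if for every clique-module $Y'$ of $d$ with $Y\cup Y'$ a clique in $G_d$, $Y\cap Y'\in\{Y,Y',\emptyset\}$. $\mathcal M(d)$ is the set of strong non-trivial clique-modules of $d$. -}

module Defs where

open import Data.Nat using (ℕ; zero; suc; _+_; _≤_)
open import Data.Bool using (Bool; true; false; T; if_then_else_)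
open import Data.Fin using (Fin; zero; suc)
open import Data.Fin.Subset using (Subset; _∈_; _∉_; _∩_; _∪_; _⊆_; ∣_∣; Nonempty)
import Data.Fin.Subset as Sub
open import Data.Sum using (_⊎_; inj₁; inj₂)
open import Data.Product using (Σ; ∃; ∃-syntax; _×_; _,_)
open import Data.Maybe using (Maybe; just; nothing)
open import Data.List using (List; []; _∷_; _∷ʳ_; length; foldr)
open import Data.List.Relation.Unary.Linked using (Linked)
open import Data.List.Relation.Unary.Unique.Propositional using (Unique)
open import Data.List.Relation.Unary.All using (All)
open import Relation.Binary.Construct.Closure.ReflexiveTransitive using (Star)
open import Relation.Binary.Construct.Closure.Transitive using (TransClosure)
open import Relation.Binary.PropositionalEquality using (_≡_; _≢_)
open import Relation.Nullary using (¬_)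
open import Function.Bundles using (_⇔_)

-- Vertex sets.  A network on X = Fin n with k non-leaf vertices has
-- vertex type  Vtx n k = Fin n ⊎ Fin k : the leaves are inj₁ x (x ∈ X),
-- and V(N) - X is {inj₂ i}.

Vtx : ℕ → ℕ → Set
Vtx n k = Fin n ⊎ Fin k

countFin : ∀ m → (Fin m → Bool) → ℕ
countFin zero    f = 0
countFin (suc m) f = (if f zero then 1 else 0) + countFin m (λ i → f (suc i))

countV : ∀ {n k} → (Vtx n k → Bool) → ℕ
countV {n} {k} f = countFin n (λ x → f (inj₁ x)) + countFin k (λ i → f (inj₂ i))

-- Digraphs given by a boolean arc relation (hence without multi-arcs).

module Digraph {n k : ℕ} (arc : Vtx n k → Vtx n k → Bool) where

  Arc : Vtx n k → Vtx n k → Set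
  Arc u v = T (arc u v)

  indeg : Vtx n k → ℕ
  indeg v = countV (λ u → arc u v)

  outdeg : Vtx n k → ℕ
  outdeg u = countV (λ v → arc u v)

  IsLeaf : Vtx n k → Set
  IsLeaf v = (indeg v ≡ 1) × (outdeg v ≡ 0)

  Ancestor : Vtx n k → Vtx n k → Set
  Ancestor = Star Arc

  Acyclic : Set
  Acyclic = ∀ v → ¬ TransClosure Arc v v

  Loopless : Set
  Loopless = ∀ v → arc v v ≡ false

  Adj : Vtx n k → Vtx n k → Set
  Adj u v = Arc u v ⊎ Arc v u

  Connected : Set
  Connected = ∀ u v → Star Adj u v

  IsCycle : Vtx n k → List (Vtx n k) → Set
  IsCycle v vs = (2 ≤ length vs) × Unique (v ∷ vs) × Linked Adj ((v ∷ vs) ∷ʳ v)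

  UndirectedAcyclic : Set
  UndirectedAcyclic = ∀ v vs → ¬ IsCycle v vs

  IsClusterOf : Vtx n k → Subset n → Set
  IsClusterOf v Y = ∀ x → (x ∈ Y) ⇔ Ancestor v (inj₁ x)

  IsLCA : Vtx n k → Fin n → Fin n → Set
  IsLCA v x y = Ancestor v (inj₁ x) × Ancestor v (inj₁ y)
              × (∀ w → Arc v w → ¬ (Ancestor w (inj₁ x) × Ancestor w (inj₁ y)))

  InternalArc : Vtx n k → Vtx n k → Set
  InternalArc u v = Arc u v × ¬ IsLeaf u × ¬ IsLeaf v

record ArborealNetwork (n k : ℕ) : Set where
  field
    arc         : Vtx n k → Vtx n k → Bool
  open Digraph arc
  field
    loopless    : Loopless
    acyclic     : Acyclic
    connected   : Connected
    leaves-X    : ∀ x → IsLeaf (inj₁ x)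
    leaves-only : ∀ i → ¬ IsLeaf (inj₂ i)
    root-out    : ∀ v → indeg v ≡ 0 → 2 ≤ outdeg v
    sink-in     : ∀ v → outdeg v ≡ 0 → indeg v ≡ 1
    no-deg11    : ∀ v → ¬ ((indeg v ≡ 1) × (outdeg v ≡ 1))
    tree        : UndirectedAcyclic

module _ {n k : ℕ} {M : Set} (N : ArborealNetwork n k) where
  open ArborealNetwork N using (arc)
  open Digraph arc

  -- d is d_{(N,t)}  (⊙ is represented by nothing)
  IsDistOf : (t : Vtx n k → M) → (Fin n → Fin n → Maybe M) → Set
  IsDistOf t d = ∀ x y → x ≢ y →
      (∀ v → IsLCA v x y → d x y ≡ just (t v))
    × ((∀ v → ¬ (Ancestor v (inj₁ x) × Ancestor v (inj₁ y))) → d x y ≡ nothing)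

  Discriminating : (t : Vtx n k → M) → Set
  Discriminating t =
      (∀ u v → InternalArc u v → outdeg u ≢ 1)
    × (∀ u v → InternalArc u v → indeg v ≡ 1 → t u ≢ t v)

AtMostTwo : {A : Set} → A → A → A → Set
AtMostTwo a b c = (a ≡ b) ⊎ (a ≡ c) ⊎ (b ≡ c)

module _ {n : ℕ} {M : Set} (d : Fin n → Fin n → Maybe M) where

  AdjG : Fin n → Fin n → Set
  AdjG x y = (x ≢ y) × (d x y ≢ nothing)

  IsClique : Subset n → Set
  IsClique Y = (2 ≤ ∣ Y ∣) × (∀ x y → x ∈ Y → y ∈ Y → x ≢ y → AdjG x y)

  IsMaxClique : Subset n → Set
  IsMaxClique Y = IsClique Y × (∀ Y′ → IsClique Y′ → Y ⊆ Y′ → Y′ ≡ Y)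

  -- 𝒞(K(G_d)) : non-empty intersections of non-empty subfamilies of K(G_d)
  -- (a finite subfamily is given by a non-empty list of its members)
  InCK : Subset n → Set
  InCK Z = Σ (Subset n) λ Y₀ → Σ (List (Subset n)) λ Ys →
             IsMaxClique Y₀ × All IsMaxClique Ys
           × (Z ≡ foldr _∩_ Y₀ Ys) × Nonempty Z

  IsCliqueModule : Subset n → Set
  IsCliqueModule Y = Nonempty Y ×
    ((∣ Y ∣ ≡ 1) ⊎
     (IsClique Y × (∀ x y z → x ∈ Y → y ∈ Y → z ∉ Y → AtMostTwo (d x z) (d y z) nothing)))

  IsStrong : Subset n → Set
  IsStrong Y = ∀ Y′ → IsCliqueModule Y′ → IsClique (Y ∪ Y′) →
               (Y ∩ Y′ ≡ Y) ⊎ (Y ∩ Y′ ≡ Y′) ⊎ (Y ∩ Y′ ≡ Sub.⊥)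

  InM : Subset n → Set
  InM Y = IsCliqueModule Y × IsStrong Y × (∣ Y ∣ ≢ 1)

  InFamily : Subset n → Set
  InFamily Y = InCK Y ⊎ InM Y

module _ {n k : ℕ} {M : Set} (N : ArborealNetwork n k) where
  open ArborealNetwork N using (arc)
  open Digraph arc

  ClusterBijection : (Fin n → Fin n → Maybe M) → Set
  ClusterBijection d =
      (∀ i → ∃[ Y ] (IsClusterOf (inj₂ i) Y × InFamily d Y))
    × (∀ i j Y → IsClusterOf (inj₂ i) Y → IsClusterOf (inj₂ j) Y → i ≡ j)
    × (∀ Y → InFamily d Y → ∃[ i ] IsClusterOf (inj₂ i) Y)

{-# OPTIONS --safe #-}

-- In an arboreal network every arc is a bridge: no undirected walk joins its endpoints
-- without using it.  Closing up directed paths to such a walk shows that a vertex above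
-- leaves of two different children of v is above v, dually that a vertex below ancestors
-- of two different parents of v is below v, and that pairwise sharing of ancestors is
-- a Helly property.  Hence the maximal cliques are the clusters of the roots, their
-- non-empty intersections are clusters, every cluster is a clique-module, and a strong
-- non-trivial one Y is the cluster of the lowest v with Y ⊆ C(v).  Conversely C(v) is an
-- intersection of root clusters when indeg v ≠ 1; when v has a single parent u it is not,
-- and then it is strong exactly if t u ≠ t v.
module Submission where

open import Defs
open import Data.Nat using (ℕ; zero; suc; _+_; _≤_; z≤n; s≤s; _≤?_)
import Data.Nat.Properties as ℕ
open import Data.Bool using (Bool; true; false; T)
import Data.Bool.Properties as Bool
open import Data.Unit using (⊤; tt)
open import Data.Empty using (⊥; ⊥-elim)
open import Data.Fin using (Fin; zero; suc; splitAt; join)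
import Data.Fin.Properties as Fin
open import Data.Fin.Induction using (spo-wellFounded; spo-noetherian)
open import Data.Fin.Subset using (Subset; _∈_; _∉_; _∩_; _∪_; _⊆_; _-_; ⁅_⁆; ∣_∣; Nonempty)
open import Data.Fin.Subset.Properties
open import Data.List using (List; []; _∷_; _∷ʳ_; foldr; map; filter; allFin)
import Data.List.Membership.DecPropositional as DecMembership
open import Data.List.Membership.Propositional using () renaming (_∈_ to _∈ₗ_)
open import Data.List.Membership.Propositional.Properties using (∈-map⁺; ∈-map⁻; ∈-filter⁺; ∈-filter⁻; ∈-allFin)
open import Data.List.Relation.Unary.All as All using (All; []; _∷_)
open import Data.List.Relation.Unary.All.Properties using (¬Any⇒All¬)
open import Data.List.Relation.Unary.AllPairs using ([]; _∷_)
open import Data.List.Relation.Unary.Any using (here; there)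
open import Data.List.Relation.Unary.Linked using (Linked; [-]; _∷_)
open import Data.List.Relation.Unary.Unique.Propositional using (Unique)
open import Data.Maybe using (Maybe; just; nothing)
open import Data.Maybe.Properties using (just-injective)
open import Data.Product using (∃; ∃₂; ∃-syntax; _×_; _,_; proj₁; proj₂)
open import Data.Sum using (_⊎_; inj₁; inj₂; [_,_]′)
import Data.Sum.Properties as Sum
open import Data.Vec using (tabulate)
open import Data.Vec.Properties using ([]=⇒lookup; lookup⇒[]=; lookup∘tabulate)
open import Function using (_∘_; flip)
open import Function.Bundles using (_⇔_; mk⇔; Equivalence)
open import Induction.WellFounded using (WellFounded; Acc; acc; module Subrelation)
import Relation.Binary.Construct.On as On
open import Relation.Binary.Construct.Closure.ReflexiveTransitive as Star using (Star; ε; _◅_; _◅◅_)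
open import Relation.Binary.Construct.Closure.Transitive as Plus using (TransClosure; [_]; _∷_)
open import Relation.Binary.Structures using (IsStrictPartialOrder)
open import Relation.Binary.PropositionalEquality using (_≡_; _≢_; refl; sym; trans; cong; subst; subst₂; isEquivalence)
open import Relation.Nullary using (¬_; Dec; yes; no; does; contradiction)
open import Relation.Nullary.Decidable using (map′; dec-true; _×-dec_; ¬?)
open import Relation.Unary using (Decidable)

-- Counting

count≥1⁺ : ∀ {m} (f : Fin m → Bool) i → T (f i) → 1 ≤ countFin m f
count≥1⁺ f zero    fi with f zero
... | true = s≤s z≤n
count≥1⁺ f (suc i) fi = ℕ.≤-trans (count≥1⁺ (f ∘ suc) i fi) (ℕ.m≤n+m _ _)

count≥2⁺ : ∀ {m} (f : Fin m → Bool) i j → i ≢ j → T (f i) → T (f j) → 2 ≤ countFin m f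
count≥2⁺ f zero    zero    i≢j fi fj = contradiction refl i≢j
count≥2⁺ f zero    (suc j) i≢j fi fj with f zero
... | true = s≤s (count≥1⁺ (f ∘ suc) j fj)
count≥2⁺ f (suc i) zero    i≢j fi fj with f zero
... | true = s≤s (count≥1⁺ (f ∘ suc) i fi)
count≥2⁺ f (suc i) (suc j) i≢j fi fj =
  ℕ.≤-trans (count≥2⁺ (f ∘ suc) i j (i≢j ∘ cong suc) fi fj) (ℕ.m≤n+m _ _)

count≥1⁻ : ∀ {m} (f : Fin m → Bool) → 1 ≤ countFin m f → ∃[ i ] T (f i)
count≥1⁻ {suc m} f 1≤c with f zero in eq
... | true  = zero , subst T (sym eq) tt
... | false = let i , fi = count≥1⁻ (f ∘ suc) 1≤c in suc i , fi

count≥2⁻ : ∀ {m} (f : Fin m → Bool) → 2 ≤ countFin m f →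
           ∃₂ λ i j → i ≢ j × T (f i) × T (f j)
count≥2⁻ {suc m} f 2≤c with f zero in eq
... | true  = let j , fj = count≥1⁻ (f ∘ suc) (ℕ.≤-pred 2≤c)
              in zero , suc j , (λ ()) , subst T (sym eq) tt , fj
... | false = let i , j , i≢j , fi , fj = count≥2⁻ (f ∘ suc) 2≤c
              in suc i , suc j , i≢j ∘ Fin.suc-injective , fi , fj

module _ {n k : ℕ} (f : Vtx n k → Bool) where

  countV≥1⁺ : ∀ v → T (f v) → 1 ≤ countV f
  countV≥1⁺ (inj₁ x) fv = ℕ.≤-trans (count≥1⁺ (f ∘ inj₁) x fv) (ℕ.m≤m+n _ _)
  countV≥1⁺ (inj₂ i) fv = ℕ.≤-trans (count≥1⁺ (f ∘ inj₂) i fv) (ℕ.m≤n+m _ _)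

  countV≥2⁺ : ∀ u v → u ≢ v → T (f u) → T (f v) → 2 ≤ countV f
  countV≥2⁺ (inj₁ x) (inj₁ y) u≢v fu fv =
    ℕ.≤-trans (count≥2⁺ (f ∘ inj₁) x y (u≢v ∘ cong inj₁) fu fv) (ℕ.m≤m+n _ _)
  countV≥2⁺ (inj₁ x) (inj₂ j) u≢v fu fv =
    ℕ.+-mono-≤ (count≥1⁺ (f ∘ inj₁) x fu) (count≥1⁺ (f ∘ inj₂) j fv)
  countV≥2⁺ (inj₂ i) (inj₁ y) u≢v fu fv =
    ℕ.+-mono-≤ (count≥1⁺ (f ∘ inj₁) y fv) (count≥1⁺ (f ∘ inj₂) i fu)
  countV≥2⁺ (inj₂ i) (inj₂ j) u≢v fu fv =
    ℕ.≤-trans (count≥2⁺ (f ∘ inj₂) i j (u≢v ∘ cong inj₂) fu fv) (ℕ.m≤n+m _ _)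

  countV≥1⁻ : 1 ≤ countV f → ∃[ v ] T (f v)
  countV≥1⁻ 1≤c with countFin n (f ∘ inj₁) in eq
  ... | zero  = let i , fi = count≥1⁻ (f ∘ inj₂) 1≤c in inj₂ i , fi
  ... | suc _ = let x , fx = count≥1⁻ (f ∘ inj₁) (subst (1 ≤_) (sym eq) (s≤s z≤n))
                in inj₁ x , fx

  countV≥2⁻ : 2 ≤ countV f → ∃₂ λ u v → u ≢ v × T (f u) × T (f v)
  countV≥2⁻ 2≤c with countFin n (f ∘ inj₁) in eq
  ... | zero = let i , j , i≢j , fi , fj = count≥2⁻ (f ∘ inj₂) 2≤c
               in inj₂ i , inj₂ j , i≢j ∘ Sum.inj₂-injective , fi , fj
  ... | suc zero = let x , fx = count≥1⁻ (f ∘ inj₁) (subst (1 ≤_) (sym eq) (s≤s z≤n))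
                       j , fj = count≥1⁻ (f ∘ inj₂) (ℕ.≤-pred 2≤c)
                   in inj₁ x , inj₂ j , (λ ()) , fx , fj
  ... | suc (suc _) = let x , y , x≢y , fx , fy = count≥2⁻ (f ∘ inj₁) (subst (2 ≤_) (sym eq) (s≤s (s≤s z≤n)))
                      in inj₁ x , inj₁ y , x≢y ∘ Sum.inj₁-injective , fx , fy

-- Finite subsets

module _ {n : ℕ} where

  two≤∣_∣ : ∀ {x y} (p : Subset n) → x ∈ p → y ∈ p → x ≢ y → 2 ≤ ∣ p ∣
  two≤∣_∣ {x} {y} p x∈p y∈p x≢y =
    ℕ.≤-trans (s≤s (subst (_≤ ∣ p - x ∣) (∣⁅x⁆∣≡1 y) (p⊆q⇒∣p∣≤∣q∣ ⁅y⁆⊆p-x)))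
              (x∈p⇒∣p-x∣<∣p∣ x∈p)
    where
    ⁅y⁆⊆p-x : ⁅ y ⁆ ⊆ p - x
    ⁅y⁆⊆p-x z∈⁅y⁆ with refl ← x∈⁅y⁆⇒x≡y y z∈⁅y⁆ = x∈p∧x≢y⇒x∈p-y y∈p (x≢y ∘ sym)

  nonempty⇒1≤∣_∣ : (p : Subset n) → Nonempty p → 1 ≤ ∣ p ∣
  nonempty⇒1≤∣ p ∣ (x , x∈p) = ℕ.≤-trans (s≤s z≤n) (x∈p⇒∣p-x∣<∣p∣ x∈p)

  1≤∣_∣⇒nonempty : (p : Subset n) → 1 ≤ ∣ p ∣ → Nonempty p
  1≤∣ p ∣⇒nonempty 1≤∣p∣ with nonempty? p
  ... | yes ne = ne
  ... | no  em with refl ← Empty-unique em = contradiction (subst (1 ≤_) (∣⊥∣≡0 n) 1≤∣p∣) λ ()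

  ⊆-or-witness : (p q : Subset n) → p ⊆ q ⊎ ∃[ x ] (x ∈ p × x ∉ q)
  ⊆-or-witness p q with Fin.any? (λ x → (x ∈? p) ×-dec ¬? (x ∈? q))
  ... | yes w = inj₂ w
  ... | no ¬w = inj₁ sub
    where
    sub : p ⊆ q
    sub {x} x∈p with x ∈? q
    ... | yes x∈q = x∈q
    ... | no  x∉q = contradiction (x , x∈p , x∉q) ¬w

  ⊆⇒∩≡ˡ : {p q : Subset n} → p ⊆ q → p ∩ q ≡ p
  ⊆⇒∩≡ˡ {p} {q} p⊆q = ⊆-antisym (p∩q⊆p p q) (λ x∈p → x∈p∩q⁺ (x∈p , p⊆q x∈p))

  ⊆⇒∩≡ʳ : {p q : Subset n} → q ⊆ p → p ∩ q ≡ q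
  ⊆⇒∩≡ʳ {p} {q} q⊆p = ⊆-antisym (p∩q⊆q p q) (λ x∈q → x∈p∩q⁺ (q⊆p x∈q , x∈q))

  ∩≡ˡ⇒⊆ : {p q : Subset n} → p ∩ q ≡ p → p ⊆ q
  ∩≡ˡ⇒⊆ {p} {q} eq x∈p = p∩q⊆q p q (subst (_ ∈_) (sym eq) x∈p)

  ∩≡ʳ⇒⊆ : {p q : Subset n} → p ∩ q ≡ q → q ⊆ p
  ∩≡ʳ⇒⊆ {p} {q} eq x∈q = p∩q⊆p p q (subst (_ ∈_) (sym eq) x∈q)

  ∩≡⊥⇒disjoint : ∀ {p q : Subset n} {x} → p ∩ q ≡ Data.Fin.Subset.⊥ → x ∈ p → x ∉ q
  ∩≡⊥⇒disjoint eq x∈p x∈q = ∉⊥ (subst (_ ∈_) eq (x∈p∩q⁺ (x∈p , x∈q)))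

module Network {n k : ℕ} (N : ArborealNetwork n k) where
  open ArborealNetwork N
  open Digraph arc

  V : Set
  V = Vtx n k

  infix 4 _≟_ _≽_ _≽?_

  _≟_ : (u v : V) → Dec (u ≡ v)
  _≟_ = Sum.≡-dec Fin._≟_ Fin._≟_

  anyV? : {P : V → Set} → Decidable P → Dec (∃ P)
  anyV? P? with Fin.any? (P? ∘ inj₁) | Fin.any? (P? ∘ inj₂)
  ... | yes (x , px) | _            = yes (inj₁ x , px)
  ... | no _         | yes (i , pi) = yes (inj₂ i , pi)
  ... | no ¬x        | no ¬i        = no λ { (inj₁ x , px) → ¬x (x , px) ; (inj₂ i , pi) → ¬i (i , pi) }

  arc? : ∀ u v → Dec (Arc u v)
  arc? u v = Bool.T? (arc u v)

  _≽_ : V → V → Set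
  _≽_ = Ancestor

  arc-≽⇒⁺ : ∀ {u v w} → Arc u v → v ≽ w → TransClosure Arc u w
  arc-≽⇒⁺ a ε        = [ a ]
  arc-≽⇒⁺ a (b ◅ bs) = a ∷ arc-≽⇒⁺ b bs

  arc⇒⋡ : ∀ {u v} → Arc u v → ¬ v ≽ u
  arc⇒⋡ a p = acyclic _ (arc-≽⇒⁺ a p)

  ≽-antisym : ∀ {u v} → u ≽ v → v ≽ u → u ≡ v
  ≽-antisym ε        q = refl
  ≽-antisym (a ◅ as) q = contradiction (as ◅◅ q) (arc⇒⋡ a)

  private
    _⊏_ : Fin (n + k) → Fin (n + k) → Set
    i ⊏ j = TransClosure Arc (splitAt n i) (splitAt n j)

    ⊏-isSPO : IsStrictPartialOrder _≡_ _⊏_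
    ⊏-isSPO = record
      { isEquivalence = isEquivalence
      ; irrefl        = λ { refl p → acyclic _ p }
      ; trans         = Plus._++_
      ; <-resp-≈      = (λ { refl p → p }) , (λ { refl p → p })
      }

    arc⇒⊏ : ∀ {u v} → Arc u v → join n k u ⊏ join n k v
    arc⇒⊏ {u} {v} a = subst₂ (TransClosure Arc) (sym (Fin.splitAt-join n k u)) (sym (Fin.splitAt-join n k v)) [ a ]

  abstract
    arc-wellFounded : WellFounded Arc
    arc-wellFounded = Subrelation.wellFounded arc⇒⊏ (On.wellFounded (join n k) (spo-wellFounded ⊏-isSPO))

    arc-noetherian : WellFounded (flip Arc)
    arc-noetherian = Subrelation.wellFounded arc⇒⊏ (On.wellFounded (join n k) (spo-noetherian ⊏-isSPO))

    _≽?_ : ∀ u v → Dec (u ≽ v)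
    u ≽? v = go u (arc-noetherian u)
      where
      go : ∀ u → Acc (flip Arc) u → Dec (u ≽ v)
      step : ∀ u → (∀ {w} → Arc u w → Acc (flip Arc) w) → ∀ w → Dec (∃ λ (_ : Arc u w) → w ≽ v)

      go u (acc rs) with u ≟ v | anyV? (step u rs)
      ... | yes refl | _                = yes ε
      ... | no _     | yes (_ , a , as) = yes (a ◅ as)
      ... | no u≢v   | no ¬step         = no λ { ε → u≢v refl ; (a ◅ as) → ¬step (_ , a , as) }

      step u rs w with arc? u w
      ... | no ¬a = no (¬a ∘ proj₁)
      ... | yes a = map′ (a ,_) proj₂ (go w (rs a))

    lowest : {P : V → Set} → Decidable P → ∀ v → P v →
             ∃[ w ] (v ≽ w × P w × (∀ c → Arc w c → ¬ P c))
    lowest {P} P? v = go v (arc-noetherian v)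
      where
      go : ∀ v → Acc (flip Arc) v → P v → ∃[ w ] (v ≽ w × P w × (∀ c → Arc w c → ¬ P c))
      go v (acc rs) pv with anyV? (λ c → arc? v c ×-dec P? c)
      ... | yes (c , a , pc) = let w , c≽w , rest = go c (rs a) pc in w , a ◅ c≽w , rest
      ... | no ¬c            = v , ε , pv , λ c a pc → ¬c (c , a , pc)

    highest : {P : V → Set} → Decidable P → ∀ v → P v →
              ∃[ w ] (w ≽ v × P w × (∀ p → Arc p w → ¬ P p))
    highest {P} P? v = go v (arc-wellFounded v)
      where
      go : ∀ v → Acc Arc v → P v → ∃[ w ] (w ≽ v × P w × (∀ p → Arc p w → ¬ P p))
      go v (acc rs) pv with anyV? (λ p → arc? p v ×-dec P? p)
      ... | yes (p , a , pp) = let w , w≽p , rest = go p (rs a) pp in w , w≽p ◅◅ a ◅ ε , rest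
      ... | no ¬p            = v , ε , pv , λ p a pp → ¬p (p , a , pp)

  separates : ∀ {u v w} → ¬ u ≽ w → v ≽ w → u ≢ v
  separates ¬u≽w v≽w refl = ¬u≽w v≽w

  last-arc : ∀ {u v} → u ≽ v → u ≢ v → ∃[ p ] (u ≽ p × Arc p v)
  last-arc ε u≢v = contradiction refl u≢v
  last-arc {u} {v} (_◅_ {j = w} a w≽v) u≢v with w ≟ v
  ... | yes refl = u , ε , a
  ... | no w≢v   = let p , w≽p , b = last-arc w≽v w≢v in p , a ◅ w≽p , b

  -- Degrees

  no-child : ∀ {v} → (∀ c → ¬ Arc v c) → outdeg v ≡ 0
  no-child {v} ¬c with outdeg v in eq
  ... | zero  = refl
  ... | suc _ = let c , a = countV≥1⁻ (arc v) (subst (1 ≤_) (sym eq) (s≤s z≤n)) in contradiction a (¬c c)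

  no-parent : ∀ {v} → (∀ p → ¬ Arc p v) → indeg v ≡ 0
  no-parent {v} ¬p with indeg v in eq
  ... | zero  = refl
  ... | suc _ = let p , a = countV≥1⁻ (λ u → arc u v) (subst (1 ≤_) (sym eq) (s≤s z≤n)) in contradiction a (¬p p)

  root-no-parent : ∀ {p v} → indeg v ≡ 0 → ¬ Arc p v
  root-no-parent {p} {v} eq a = ℕ.<⇒≢ (countV≥1⁺ (λ u → arc u v) p a) (sym eq)

  unique-parent : ∀ {p q v} → indeg v ≡ 1 → Arc p v → Arc q v → p ≡ q
  unique-parent {p} {q} {v} eq a b with p ≟ q
  ... | yes p≡q = p≡q
  ... | no p≢q  = contradiction (sym eq) (ℕ.<⇒≢ (countV≥2⁺ (λ u → arc u v) p q p≢q a b))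

  unique-child : ∀ {v c e} → outdeg v ≡ 1 → Arc v c → Arc v e → c ≡ e
  unique-child {v} {c} {e} eq a b with c ≟ e
  ... | yes c≡e = c≡e
  ... | no c≢e  = contradiction (sym eq) (ℕ.<⇒≢ (countV≥2⁺ (arc v) c e c≢e a b))

  leaf-no-child : ∀ {x c} → ¬ Arc (inj₁ x) c
  leaf-no-child {x} {c} a = ℕ.<⇒≢ (countV≥1⁺ (arc (inj₁ x)) c a) (sym (proj₂ (leaves-X x)))

  leaf-≽ : ∀ {x v} → inj₁ x ≽ v → inj₁ x ≡ v
  leaf-≽ ε       = refl
  leaf-≽ (a ◅ _) = contradiction a leaf-no-child

  outdeg-internal : ∀ i → outdeg (inj₂ i) ≢ 0
  outdeg-internal i eq = leaves-only i (sink-in (inj₂ i) eq , eq)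

  two-children : ∀ {v} → outdeg v ≢ 0 → outdeg v ≢ 1 → ∃₂ λ a b → a ≢ b × Arc v a × Arc v b
  two-children {v} ≢0 ≢1 with outdeg v in eq
  ... | 0           = contradiction refl ≢0
  ... | 1           = contradiction refl ≢1
  ... | suc (suc _) = countV≥2⁻ (arc v) (subst (2 ≤_) (sym eq) (s≤s (s≤s z≤n)))

  leaf-below : ∀ v → ∃[ x ] v ≽ inj₁ x
  leaf-below v with lowest {P = λ _ → ⊤} (λ _ → yes tt) v tt
  ... | inj₁ x , v≽x , _          = x , v≽x
  ... | inj₂ i , _   , _ , ¬child = contradiction (no-child λ c a → ¬child c a tt) (outdeg-internal i)

  root-above : ∀ v → ∃[ r ] (indeg r ≡ 0 × r ≽ v)
  root-above v = let r , r≽v , _ , ¬parent = highest {P = λ _ → ⊤} (λ _ → yes tt) v tt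
                 in r , no-parent (λ p a → ¬parent p a tt) , r≽v

  first-arc : ∀ {v a x} → Arc v a → v ≽ inj₁ x → ∃[ c ] (Arc v c × c ≽ inj₁ x)
  first-arc va ε          = contradiction va leaf-no-child
  first-arc va (vc ◅ c≽x) = _ , vc , c≽x

  -- Every arc is a bridge

  Off : V → V → V → V → Set
  Off a b u v = Arc u v × ¬ (u ≡ a × v ≡ b)

  Walk : V → V → V → V → Set
  Walk a b = Star (λ u v → Off a b u v ⊎ Off a b v u)

  -- The last vertex of a path is not listed.
  data Path (a b : V) : V → List V → Set where
    nil  : Path a b a []
    cons : ∀ {u w l} → Off a b u w ⊎ Off a b w u → Path a b w l → Path a b u (u ∷ l)

  SimplePath : V → V → V → Set
  SimplePath a b u = ∃[ l ] (Path a b u l × Unique (a ∷ l))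

  open DecMembership _≟_ using () renaming (_∈?_ to _∈ₗ?_)

  shortcut : ∀ {a b u w l} → Path a b w l → Unique (a ∷ l) → u ∈ₗ l → SimplePath a b u
  shortcut p@(cons _ _) uq (here refl) = _ , p , uq
  shortcut (cons _ p) ((_ ∷ as) ∷ (_ ∷ uq)) (there u∈l) = shortcut p (as ∷ uq) u∈l

  loop-erase : ∀ {a b u} → Walk a b u a → SimplePath a b u
  loop-erase ε = [] , nil , [] ∷ []
  loop-erase {a} {b} {u} (s ◅ ss) with u ≟ a | loop-erase ss
  ... | yes refl | _ = [] , nil , [] ∷ []
  ... | no u≢a   | l , p , uq@(a∉l ∷ uql) with u ∈ₗ? l
  ...   | yes u∈l = shortcut p uq u∈l
  ...   | no  u∉l = u ∷ l , cons s p , ((u≢a ∘ sym) ∷ a∉l) ∷ ¬Any⇒All¬ l u∉l ∷ uql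

  path-linked : ∀ {a b z u l} → Adj z u → Path a b u l → Linked Adj (z ∷ (l ∷ʳ a))
  path-linked zu nil = zu ∷ [-]
  path-linked zu (cons (inj₁ (uw , _)) p) = zu ∷ path-linked (inj₁ uw) p
  path-linked zu (cons (inj₂ (wu , _)) p) = zu ∷ path-linked (inj₂ wu) p

  bridge : ∀ {a b} → Arc a b → ¬ Walk a b b a
  bridge {a} {b} ab walk with loop-erase walk
  ... | _ , nil , _ = subst T (loopless a) ab
  ... | _ , cons (inj₁ (ba , _)) nil , _ = arc⇒⋡ ab (ba ◅ ε)
  ... | _ , cons (inj₂ (_ , ≢ab)) nil , _ = ≢ab (refl , refl)
  ... | l , p@(cons _ (cons _ _)) , uq = tree a l (s≤s (s≤s z≤n) , uq , path-linked (inj₁ ab) p)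

  down : ∀ {a b u v} → ¬ (u ≽ a × b ≽ v) → u ≽ v → Walk a b u v
  down avoid ε = ε
  down avoid (uw ◅ w≽v) =
    inj₁ (uw , λ { (refl , refl) → avoid (ε , w≽v) }) ◅ down (λ (w≽a , b≽v) → avoid (uw ◅ w≽a , b≽v)) w≽v

  up : ∀ {a b u v} → ¬ (u ≽ a × b ≽ v) → u ≽ v → Walk a b v u
  up avoid u≽v = Star.reverse [ inj₂ , inj₁ ]′ (down avoid u≽v)

  branch : ∀ {v a b x y w} → Arc v a → Arc v b → a ≢ b → a ≽ x → b ≽ y → w ≽ x → w ≽ y → w ≽ v
  branch {v} {w = w} va vb a≢b a≽x b≽y w≽x w≽y with w ≽? v
  ... | yes w≽v = w≽v
  ... | no ¬w≽v = contradiction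
    (down (arc⇒⋡ va ∘ proj₁) a≽x ◅◅ up (¬w≽v ∘ proj₁) w≽x ◅◅ down (¬w≽v ∘ proj₁) w≽y
      ◅◅ up (arc⇒⋡ vb ∘ proj₁) b≽y ◅◅ inj₂ (vb , a≢b ∘ sym ∘ proj₂) ◅ ε)
    (bridge va)

  merge : ∀ {p q v r s x} → Arc p v → Arc q v → p ≢ q → r ≽ p → s ≽ q → r ≽ x → s ≽ x → v ≽ x
  merge {v = v} {x = x} pv qv p≢q r≽p s≽q r≽x s≽x with v ≽? x
  ... | yes v≽x = v≽x
  ... | no ¬v≽x = contradiction
    (inj₂ (qv , p≢q ∘ sym ∘ proj₁) ◅ up (arc⇒⋡ qv ∘ proj₂) s≽q ◅◅ down (¬v≽x ∘ proj₂) s≽x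
      ◅◅ up (¬v≽x ∘ proj₂) r≽x ◅◅ down (arc⇒⋡ pv ∘ proj₂) r≽p)
    (bridge pv)

  children-disjoint : ∀ {v a b x} → Arc v a → Arc v b → a ≽ x → b ≽ x → a ≡ b
  children-disjoint {a = a} {b} va vb a≽x b≽x with a ≟ b
  ... | yes a≡b = a≡b
  ... | no a≢b  = contradiction (branch va vb a≢b a≽x b≽x a≽x a≽x) (arc⇒⋡ va)

  enters : ∀ {p q y} → ¬ q ≽ p → q ≽ y → p ≽ y →
           ∃₂ λ u w → Arc u w × p ≽ u × w ≽ y × ¬ q ≽ u × q ≽ w
  enters ¬q≽p q≽y ε = contradiction q≽y ¬q≽p
  enters {p} {q} ¬q≽p q≽y (_◅_ {j = p′} a p′≽y) with q ≽? p′
  ... | yes q≽p′ = p , p′ , a , ε , p′≽y , ¬q≽p , q≽p′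
  ... | no ¬q≽p′ = let u , w , uw , p′≽u , rest = enters ¬q≽p′ q≽y p′≽y
                   in u , w , uw , a ◅ p′≽u , rest

  -- If neither holds, the first arc of the path p ⟶ y entering the descendants of q
  -- is avoided by the rest of the closed walk p ⟶ y ⟵ q ⟶ z ⟵ r ⟶ x ⟵ p.
  helly₃ : ∀ {p q r x y z} → p ≽ x → p ≽ y → q ≽ y → q ≽ z → r ≽ x → r ≽ z → q ≽ x ⊎ r ≽ y
  helly₃ {p} {q} {r} {x} {y} p≽x p≽y q≽y q≽z r≽x r≽z with q ≽? x | r ≽? y
  ... | yes q≽x | _       = inj₁ q≽x
  ... | no _    | yes r≽y = inj₂ r≽y
  ... | no ¬q≽x | no ¬r≽y with enters (λ q≽p → ¬q≽x (q≽p ◅◅ p≽x)) q≽y p≽y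
  ...   | u , w , uw , p≽u , w≽y , ¬q≽u , q≽w = contradiction
    (up (¬q≽u ∘ proj₁) q≽w ◅◅ down (¬q≽u ∘ proj₁) q≽z ◅◅ up off-r r≽z ◅◅ down off-r r≽x
      ◅◅ up (λ (_ , w≽x) → ¬q≽x (q≽w ◅◅ w≽x)) p≽x ◅◅ down (arc⇒⋡ uw ∘ proj₂) p≽u)
    (bridge uw)
    where
    off-r : ∀ {v} → ¬ (r ≽ u × w ≽ v)
    off-r (r≽u , _) = ¬r≽y (r≽u ◅◅ uw ◅ w≽y)

  -- Lowest common ancestors and clusters

  Split : V → V → V → Set
  Split v x y = ∃₂ λ a b → Arc v a × Arc v b × a ≢ b × a ≽ x × b ≽ y

  Split-sym : ∀ {v x y} → Split v x y → Split v y x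
  Split-sym (a , b , va , vb , a≢b , a≽x , b≽y) = b , a , vb , va , a≢b ∘ sym , b≽y , a≽x

  Split-≽ : ∀ {v x y} → Split v x y → v ≽ x × v ≽ y
  Split-≽ (_ , _ , va , vb , _ , a≽x , b≽y) = va ◅ a≽x , vb ◅ b≽y

  Split-mono : ∀ {v x y x′ y′} → x ≽ x′ → y ≽ y′ → Split v x y → Split v x′ y′
  Split-mono x≽x′ y≽y′ (a , b , va , vb , a≢b , a≽x , b≽y) =
    a , b , va , vb , a≢b , a≽x ◅◅ x≽x′ , b≽y ◅◅ y≽y′

  Split-lowest : ∀ {v w x y} → Split v x y → w ≽ x → w ≽ y → w ≽ v
  Split-lowest (_ , _ , va , vb , a≢b , a≽x , b≽y) = branch va vb a≢b a≽x b≽y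

  Split-≢ : ∀ {v x y} → Split v x y → x ≢ y
  Split-≢ (_ , _ , va , vb , a≢b , a≽x , b≽y) refl = a≢b (children-disjoint va vb a≽x b≽y)

  Split⇒IsLCA : ∀ {v x y} → Split v (inj₁ x) (inj₁ y) → IsLCA v x y
  Split⇒IsLCA (_ , _ , va , vb , a≢b , a≽x , b≽y) =
    va ◅ a≽x , vb ◅ b≽y ,
    λ w vw (w≽x , w≽y) → a≢b (trans (children-disjoint va vw a≽x w≽x) (children-disjoint vw vb w≽y b≽y))

  Share : V → V → Set
  Share x y = ∃[ v ] (v ≽ x × v ≽ y)

  share? : ∀ x y → Dec (Share x y)
  share? x y = anyV? (λ v → (v ≽? x) ×-dec (v ≽? y))

  share⇒split : ∀ {x y} → x ≢ y → Share (inj₁ x) (inj₁ y) → ∃[ v ] Split v (inj₁ x) (inj₁ y)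
  share⇒split {x} {y} x≢y (v , v≽x,y)
    with lowest (λ w → (w ≽? inj₁ x) ×-dec (w ≽? inj₁ y)) v v≽x,y
  ... | w , _ , (ε , x≽y) , _ = contradiction (Sum.inj₁-injective (leaf-≽ x≽y)) x≢y
  ... | w , _ , (yc ◅ _ , ε) , _ = contradiction yc leaf-no-child
  ... | w , _ , (wa ◅ a≽x , wb ◅ b≽y) , low =
    w , _ , _ , wa , wb , (λ { refl → low _ wa (a≽x , b≽y) }) , a≽x , b≽y

  abstract
    cluster : V → Subset n
    cluster v = tabulate (λ x → does (v ≽? inj₁ x))

    ∈-cluster⁺ : ∀ {v x} → v ≽ inj₁ x → x ∈ cluster v
    ∈-cluster⁺ {v} {x} v≽x = lookup⇒[]= x (cluster v)
      (trans (lookup∘tabulate _ x) (dec-true (v ≽? inj₁ x) v≽x))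

    ∈-cluster⁻ : ∀ {v x} → x ∈ cluster v → v ≽ inj₁ x
    ∈-cluster⁻ {v} {x} x∈ with v ≽? inj₁ x | trans (sym ([]=⇒lookup x∈)) (lookup∘tabulate (λ y → does (v ≽? inj₁ y)) x)
    ... | yes v≽x | _ = v≽x

  cluster-isClusterOf : ∀ v → IsClusterOf v (cluster v)
  cluster-isClusterOf v x = mk⇔ ∈-cluster⁻ ∈-cluster⁺

  isClusterOf⇒≡ : ∀ {v Y} → IsClusterOf v Y → Y ≡ cluster v
  isClusterOf⇒≡ C = ⊆-antisym (λ x∈Y → ∈-cluster⁺ (Equivalence.to (C _) x∈Y))
                              (λ x∈C → Equivalence.from (C _) (∈-cluster⁻ x∈C))

  cluster-nonempty : ∀ v → Nonempty (cluster v)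
  cluster-nonempty v = let x , v≽x = leaf-below v in x , ∈-cluster⁺ v≽x

  cluster-injective : ∀ {u v} → outdeg u ≢ 0 → outdeg u ≢ 1 → outdeg v ≢ 0 → outdeg v ≢ 1 →
                      cluster u ≡ cluster v → u ≡ v
  cluster-injective {u} {v} u≢0 u≢1 v≢0 v≢1 eq =
    ≽-antisym (above v≢0 v≢1 (sym eq)) (above u≢0 u≢1 eq)
    where
    above : ∀ {u v} → outdeg u ≢ 0 → outdeg u ≢ 1 → cluster u ≡ cluster v → v ≽ u
    above u≢0 u≢1 eq =
      let a , b , a≢b , ua , ub = two-children u≢0 u≢1
          x , a≽x = leaf-below a
          y , b≽y = leaf-below b
          v≽ : ∀ {z} → _ ≽ inj₁ z → _ ≽ inj₁ z
          v≽ = λ u≽z → ∈-cluster⁻ (subst (_ ∈_) eq (∈-cluster⁺ u≽z))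
      in branch ua ub a≢b a≽x b≽y (v≽ (ua ◅ a≽x)) (v≽ (ub ◅ b≽y))

  common-ancestor : ∀ x₀ (L : List V) → (∀ {x y} → x ∈ₗ x₀ ∷ L → y ∈ₗ x₀ ∷ L → Share x y) →
                    ∃[ v ] (∀ {x} → x ∈ₗ x₀ ∷ L → v ≽ x)
  common-ancestor x₀ [] share = x₀ , λ { (here refl) → ε }
  common-ancestor x₀ (y ∷ L) share
    with common-ancestor x₀ L (λ x∈ y∈ → share (keep x∈) (keep y∈))
    where
    keep : ∀ {x} → x ∈ₗ x₀ ∷ L → x ∈ₗ x₀ ∷ y ∷ L
    keep (here eq)  = here eq
    keep (there x∈) = there (there x∈)
  ... | v , v≽ with v ≽? y
  ...   | yes v≽y = v , λ { (here eq) → v≽ (here eq) ; (there (here refl)) → v≽y ; (there (there x∈)) → v≽ (there x∈) }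
  ...   | no ¬v≽y with share (here refl) (there (here refl))
  ...     | p , p≽x₀ , p≽y = p , p≽
    where
    p≽ : ∀ {x} → x ∈ₗ x₀ ∷ y ∷ L → p ≽ x
    p≽ (here refl)         = p≽x₀
    p≽ (there (here refl)) = p≽y
    p≽ (there (there x∈)) with share (there (there x∈)) (there (here refl))
    ... | q , q≽x , q≽y with helly₃ q≽y q≽x (v≽ (there x∈)) (v≽ (here refl)) p≽y p≽x₀
    ...   | inj₁ v≽y = contradiction v≽y ¬v≽y
    ...   | inj₂ p≽x = p≽x

  module Labelled {M : Set} (t : V → M) (d : Fin n → Fin n → Maybe M) (dist : IsDistOf N t d) where

    d-split : ∀ {v x y} → Split v (inj₁ x) (inj₁ y) → d x y ≡ just (t v)
    d-split {v} {x} {y} s = proj₁ (dist x y (Split-≢ s ∘ cong inj₁)) v (Split⇒IsLCA s)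

    d-unshared : ∀ {x y} → x ≢ y → ¬ Share (inj₁ x) (inj₁ y) → d x y ≡ nothing
    d-unshared {x} {y} x≢y ¬s = proj₂ (dist x y x≢y) (λ v v≽ → ¬s (v , v≽))

    share⇒adj : ∀ {x y} → x ≢ y → Share (inj₁ x) (inj₁ y) → AdjG d x y
    share⇒adj x≢y s = x≢y , λ eq → let _ , sp = share⇒split x≢y s
                                  in contradiction (trans (sym eq) (d-split sp)) λ ()

    adj⇒share : ∀ {x y} → AdjG d x y → Share (inj₁ x) (inj₁ y)
    adj⇒share {x} {y} (x≢y , ≢⊙) with share? (inj₁ x) (inj₁ y)
    ... | yes s = s
    ... | no ¬s = contradiction (d-unshared x≢y ¬s) ≢⊙

    ⊆cluster⇒clique : ∀ {v Y} → Y ⊆ cluster v → 2 ≤ ∣ Y ∣ → IsClique d Y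
    ⊆cluster⇒clique Y⊆ 2≤ = 2≤ , λ x y x∈ y∈ x≢y →
      share⇒adj x≢y (_ , ∈-cluster⁻ (Y⊆ x∈) , ∈-cluster⁻ (Y⊆ y∈))

    clique⇒⊆cluster : ∀ {Y} → IsClique d Y → ∃[ v ] Y ⊆ cluster v
    clique⇒⊆cluster {Y} (2≤ , adj) =
      let x₀ , x₀∈Y = 1≤∣ Y ∣⇒nonempty (ℕ.≤-trans (s≤s z≤n) 2≤)
          v , v≽    = common-ancestor (inj₁ x₀) elements λ x∈ y∈ → share (leaf∈Y x₀∈Y x∈) (leaf∈Y x₀∈Y y∈)
      in v , λ x∈Y → ∈-cluster⁺ (v≽ (there (∈-map⁺ inj₁ (∈-filter⁺ (_∈? Y) (∈-allFin _) x∈Y))))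
      where
      elements : List V
      elements = map inj₁ (filter (_∈? Y) (allFin n))

      leaf∈Y : ∀ {x₀ x} → x₀ ∈ Y → x ∈ₗ inj₁ x₀ ∷ elements → ∃[ y ] (y ∈ Y × x ≡ inj₁ y)
      leaf∈Y x₀∈Y (here refl) = _ , x₀∈Y , refl
      leaf∈Y x₀∈Y (there x∈) =
        let y , y∈ , eq = ∈-map⁻ inj₁ x∈
        in y , proj₂ (∈-filter⁻ (_∈? Y) {xs = allFin n} y∈) , eq

      share : ∀ {x y} → ∃[ x′ ] (x′ ∈ Y × x ≡ inj₁ x′) → ∃[ y′ ] (y′ ∈ Y × y ≡ inj₁ y′) → Share x y
      share (x , x∈Y , refl) (y , y∈Y , refl) with x Fin.≟ y
      ... | yes refl = inj₁ x , ε , ε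
      ... | no x≢y   = adj⇒share (adj x y x∈Y y∈Y x≢y)

    root-cluster-maximal : ∀ {r} → indeg r ≡ 0 → IsMaxClique d (cluster r)
    root-cluster-maximal {r} root with countV≥2⁻ (arc r) (root-out r root)
    ... | a , b , a≢b , ra , rb with leaf-below a | leaf-below b
    ...   | x , a≽x | y , b≽y =
      ⊆cluster⇒clique (λ z∈ → z∈) (two≤∣ cluster r ∣ (∈-cluster⁺ r≽x) (∈-cluster⁺ r≽y) x≢y) , maximal
      where
      r≽x = ra ◅ a≽x
      r≽y = rb ◅ b≽y
      x≢y : x ≢ y
      x≢y x≡y = Split-≢ (a , b , ra , rb , a≢b , a≽x , b≽y) (cong inj₁ x≡y)
      maximal : ∀ Y′ → IsClique d Y′ → cluster r ⊆ Y′ → Y′ ≡ cluster r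
      maximal Y′ cl C⊆Y′ with clique⇒⊆cluster cl
      ... | v , Y′⊆C with r ≟ v
      ...   | yes refl = ⊆-antisym Y′⊆C C⊆Y′
      ...   | no r≢v =
        let v≽ = λ {z} (r≽z : r ≽ inj₁ z) → ∈-cluster⁻ (Y′⊆C (C⊆Y′ (∈-cluster⁺ r≽z)))
            _ , _ , pr = last-arc (branch ra rb a≢b a≽x b≽y (v≽ r≽x) (v≽ r≽y)) (r≢v ∘ sym)
        in contradiction pr (root-no-parent root)

    maximal-clique⇒root : ∀ {Y} → IsMaxClique d Y → ∃[ r ] (indeg r ≡ 0 × Y ≡ cluster r)
    maximal-clique⇒root {Y} (cl , maximal) =
      let v , Y⊆C      = clique⇒⊆cluster cl
          r , rt , r≽v = root-above v
          Y⊆Cr         = λ {x} (x∈Y : x ∈ Y) → ∈-cluster⁺ (r≽v ◅◅ ∈-cluster⁻ (Y⊆C x∈Y))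
      in r , rt , sym (maximal (cluster r) (proj₁ (root-cluster-maximal rt)) Y⊆Cr)

    CK⇒roots : ∀ {Z} → InCK d Z → ∃[ r ] ∃[ rs ]
               (All (λ r → indeg r ≡ 0) (r ∷ rs) ×
                (∀ x → x ∈ Z → All (_≽ inj₁ x) (r ∷ rs)) ×
                (∀ x → All (_≽ inj₁ x) (r ∷ rs) → x ∈ Z))
    CK⇒roots (Y₀ , Ys , max₀ , maxs , refl , _) = go Ys maxs
      where
      go : ∀ Ys → All (IsMaxClique d) Ys → ∃[ r ] ∃[ rs ]
           (All (λ r → indeg r ≡ 0) (r ∷ rs) ×
            (∀ x → x ∈ foldr _∩_ Y₀ Ys → All (_≽ inj₁ x) (r ∷ rs)) ×
            (∀ x → All (_≽ inj₁ x) (r ∷ rs) → x ∈ foldr _∩_ Y₀ Ys))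
      go [] [] with maximal-clique⇒root max₀
      ... | r , rt , refl = r , [] , rt ∷ [] , (λ x x∈ → ∈-cluster⁻ x∈ ∷ []) , λ { x (r≽x ∷ []) → ∈-cluster⁺ r≽x }
      go (Y ∷ Ys) (mx ∷ mxs) with maximal-clique⇒root mx | go Ys mxs
      ... | r , rt , refl | r′ , rs , rts , to , from =
        r , r′ ∷ rs , rt ∷ rts ,
        (λ x x∈ → let x∈C , x∈I = x∈p∩q⁻ _ _ x∈ in ∈-cluster⁻ x∈C ∷ to x x∈I) ,
        λ { x (r≽x ∷ rs≽x) → x∈p∩q⁺ (∈-cluster⁺ r≽x , from x rs≽x) }

    -- The highest vertex w below all the roots that lies above some x₀ ∈ Z has cluster Z.
    CK⇒cluster : ∀ {Z} → InCK d Z → ∃[ i ] IsClusterOf (inj₂ i) Z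
    CK⇒cluster {Z} ck@(_ , _ , _ , _ , _ , x₀ , x₀∈Z) with CK⇒roots ck
    ... | r , rs , rt ∷ rts , to , from
      with highest (λ w → All.all? (_≽? w) (r ∷ rs)) (inj₁ x₀) (to x₀ x₀∈Z)
    ...   | inj₁ x , _ , rs≽x , high with leaf-parent
      where
      leaf-parent : ∃[ p ] Arc p (inj₁ x)
      leaf-parent = countV≥1⁻ (λ u → arc u (inj₁ x)) (ℕ.≤-reflexive (sym (proj₁ (leaves-X x))))
    ...     | p , px = contradiction (All.zipWith through (rt ∷ rts , rs≽x)) (high p px)
      where
      through : ∀ {s} → indeg s ≡ 0 × s ≽ inj₁ x → s ≽ p
      through (st , s≽x) with last-arc s≽x (λ { refl → contradiction (trans (sym st) (proj₁ (leaves-X x))) λ () })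
      ... | q , s≽q , qx with refl ← unique-parent (proj₁ (leaves-X x)) qx px = s≽q
    CK⇒cluster {Z} ck | r , rs , rts , to , from | inj₂ i , w≽x₀ , rs≽w , high =
      i , λ x → mk⇔ (λ x∈Z → w≽ (to x x∈Z)) (λ w≽x → from x (All.map (_◅◅ w≽x) rs≽w))
      where
      w : V
      w = inj₂ i

      w≽ : ∀ {x} → All (_≽ inj₁ x) (r ∷ rs) → w ≽ inj₁ x
      w≽ {x} rs≽x@(r≽x ∷ _) with r ≟ w
      ... | yes refl = r≽x
      ... | no r≢w with last-arc (All.head rs≽w) r≢w
      ...   | p , r≽p , pw = go rs≽x rs≽w (high p pw)
        where
        go : ∀ {ss} → All (_≽ inj₁ x) ss → All (_≽ w) ss → ¬ All (_≽ p) ss → w ≽ inj₁ x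
        go [] [] ¬all = contradiction [] ¬all
        go {s ∷ _} (s≽x ∷ ss≽x) (s≽w ∷ ss≽w) ¬all with s ≽? p | s ≟ w
        ... | yes s≽p | _        = go ss≽x ss≽w (¬all ∘ (s≽p ∷_))
        ... | no _    | yes refl = s≽x
        ... | no ¬s≽p | no s≢w   =
          let q , s≽q , qw = last-arc s≽w s≢w
          in merge pw qw (λ { refl → ¬s≽p s≽q }) r≽p s≽q r≽x s≽x

    cluster-two-valued : ∀ {v x y z} → v ≽ inj₁ x → v ≽ inj₁ y → ¬ v ≽ inj₁ z →
                         AtMostTwo (d x z) (d y z) nothing
    cluster-two-valued {v} {x} {y} {z} v≽x v≽y ¬v≽z
      with share? (inj₁ x) (inj₁ z) | share? (inj₁ y) (inj₁ z)
    ... | no ¬s | _     = inj₂ (inj₁ (d-unshared (λ { refl → ¬v≽z v≽x }) ¬s))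
    ... | yes _ | no ¬s = inj₂ (inj₂ (d-unshared (λ { refl → ¬v≽z v≽y }) ¬s))
    ... | yes s | yes s′ with share⇒split (λ { refl → ¬v≽z v≽x }) s | share⇒split (λ { refl → ¬v≽z v≽y }) s′
    ...   | p , sp | q , sq = inj₁ (trans (d-split sp) (trans (cong (just ∘ t) p≡q) (sym (d-split sq))))
      where
      above : ∀ {p q x y} → v ≽ inj₁ x → v ≽ inj₁ y → Split p (inj₁ x) (inj₁ z) → Split q (inj₁ y) (inj₁ z) → q ≽ p
      above v≽x v≽y sp sq with helly₃ (proj₂ (Split-≽ sp)) (proj₁ (Split-≽ sp)) v≽x v≽y (proj₂ (Split-≽ sq)) (proj₁ (Split-≽ sq))
      ... | inj₁ v≽z = contradiction v≽z ¬v≽z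
      ... | inj₂ q≽x = Split-lowest sp q≽x (proj₂ (Split-≽ sq))

      p≡q : p ≡ q
      p≡q = ≽-antisym (above v≽y v≽x sq sp) (above v≽x v≽y sp sq)

    cluster-module : ∀ v → IsCliqueModule d (cluster v)
    cluster-module v = cluster-nonempty v , size
      where
      size : ∣ cluster v ∣ ≡ 1 ⊎ _
      size with 2 ≤? ∣ cluster v ∣
      ... | yes 2≤ = inj₂ (⊆cluster⇒clique (λ z∈ → z∈) 2≤ ,
        λ x y z x∈ y∈ z∉ → cluster-two-valued (∈-cluster⁻ x∈) (∈-cluster⁻ y∈) (z∉ ∘ ∈-cluster⁺))
      ... | no ¬2≤ = inj₁ (ℕ.≤-antisym (ℕ.≤-pred (ℕ.≰⇒> ¬2≤)) (nonempty⇒1≤∣ cluster v ∣ (cluster-nonempty v)))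

    union-module : ∀ {u a b} → u ≽ a → u ≽ b → (∀ {x} → a ≽ x → ¬ b ≽ x) →
      (∀ {x y z} → a ≽ inj₁ x → b ≽ inj₁ y → u ≽ inj₁ z → ¬ a ≽ inj₁ z → ¬ b ≽ inj₁ z → d x z ≡ d y z) →
      IsCliqueModule d (cluster a ∪ cluster b)
    union-module {u} {a} {b} u≽a u≽b disjoint agree =
      (α , α∈) , inj₂ (⊆cluster⇒clique ⊆u (two≤∣ _ ∣ α∈ β∈ (λ α≡β → disjoint a≽α (subst (λ x → b ≽ inj₁ x) (sym α≡β) b≽β))) , two-valued)
      where
      α = proj₁ (leaf-below a)
      β = proj₁ (leaf-below b)
      a≽α = proj₂ (leaf-below a)
      b≽β = proj₂ (leaf-below b)
      α∈ : α ∈ cluster a ∪ cluster b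
      α∈ = x∈p∪q⁺ (inj₁ (∈-cluster⁺ a≽α))
      β∈ : β ∈ cluster a ∪ cluster b
      β∈ = x∈p∪q⁺ (inj₂ (∈-cluster⁺ b≽β))

      ⊆u : cluster a ∪ cluster b ⊆ cluster u
      ⊆u x∈ with x∈p∪q⁻ (cluster a) (cluster b) x∈
      ... | inj₁ x∈a = ∈-cluster⁺ (u≽a ◅◅ ∈-cluster⁻ x∈a)
      ... | inj₂ x∈b = ∈-cluster⁺ (u≽b ◅◅ ∈-cluster⁻ x∈b)

      mixed : ∀ {x y z} → a ≽ inj₁ x → b ≽ inj₁ y → ¬ a ≽ inj₁ z → ¬ b ≽ inj₁ z →
              d x z ≡ d y z ⊎ d x z ≡ nothing ⊎ d y z ≡ nothing
      mixed {z = z} a≽x b≽y ¬a≽z ¬b≽z with u ≽? inj₁ z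
      ... | yes u≽z = inj₁ (agree a≽x b≽y u≽z ¬a≽z ¬b≽z)
      ... | no ¬u≽z = cluster-two-valued (u≽a ◅◅ a≽x) (u≽b ◅◅ b≽y) ¬u≽z

      two-valued : ∀ x y z → x ∈ cluster a ∪ cluster b → y ∈ cluster a ∪ cluster b →
                   z ∉ cluster a ∪ cluster b → AtMostTwo (d x z) (d y z) nothing
      two-valued x y z x∈ y∈ z∉ with x∈p∪q⁻ (cluster a) (cluster b) x∈ | x∈p∪q⁻ (cluster a) (cluster b) y∈
      ... | inj₁ x∈a | inj₁ y∈a = cluster-two-valued (∈-cluster⁻ x∈a) (∈-cluster⁻ y∈a) (z∉ ∘ x∈p∪q⁺ ∘ inj₁ ∘ ∈-cluster⁺)
      ... | inj₂ x∈b | inj₂ y∈b = cluster-two-valued (∈-cluster⁻ x∈b) (∈-cluster⁻ y∈b) (z∉ ∘ x∈p∪q⁺ ∘ inj₂ ∘ ∈-cluster⁺)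
      ... | inj₁ x∈a | inj₂ y∈b = mixed (∈-cluster⁻ x∈a) (∈-cluster⁻ y∈b) (z∉ ∘ x∈p∪q⁺ ∘ inj₁ ∘ ∈-cluster⁺) (z∉ ∘ x∈p∪q⁺ ∘ inj₂ ∘ ∈-cluster⁺)
      ... | inj₂ x∈b | inj₁ y∈a with mixed (∈-cluster⁻ y∈a) (∈-cluster⁻ x∈b) (z∉ ∘ x∈p∪q⁺ ∘ inj₁ ∘ ∈-cluster⁺) (z∉ ∘ x∈p∪q⁺ ∘ inj₂ ∘ ∈-cluster⁺)
      ...   | inj₁ eq        = inj₁ (sym eq)
      ...   | inj₂ (inj₁ eq) = inj₂ (inj₂ eq)
      ...   | inj₂ (inj₂ eq) = inj₂ (inj₁ eq)

    -- For distinct children a, b of the lowest v with Y ⊆ C(v), where a is above some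
    -- element of Y and b above none, C(a) ∪ C(b) is a clique-module that overlaps Y.
    M⇒cluster : ∀ {Y} → InM d Y → ∃[ i ] IsClusterOf (inj₂ i) Y
    M⇒cluster ((_ , inj₁ ∣Y∣≡1) , _ , ∣Y∣≢1) = contradiction ∣Y∣≡1 ∣Y∣≢1
    M⇒cluster {Y} (((y₀ , y₀∈Y) , inj₂ (cl@(2≤ , _) , _)) , strong , _)
      with clique⇒⊆cluster cl
    ... | v₀ , Y⊆v₀ with lowest (λ v → Y ⊆? cluster v) v₀ Y⊆v₀
    ...   | inj₁ x , _ , Y⊆x , _ =
      contradiction (ℕ.≤-trans 2≤ (p⊆q⇒∣p∣≤∣q∣ Y⊆⁅x⁆)) (ℕ.<⇒≱ (s≤s (ℕ.≤-reflexive (∣⁅x⁆∣≡1 x))))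
      where
      Y⊆⁅x⁆ : Y ⊆ ⁅ x ⁆
      Y⊆⁅x⁆ y∈Y with refl ← leaf-≽ (∈-cluster⁻ (Y⊆x y∈Y)) = x∈⁅x⁆ x
    ...   | inj₂ i , _ , Y⊆v , low = i , λ x → mk⇔ (λ x∈Y → ∈-cluster⁻ (Y⊆v x∈Y)) v⊆Y
      where
      v : V
      v = inj₂ i

      ∪-clique : ∀ {Y′} → Y′ ⊆ cluster v → IsClique d (Y ∪ Y′)
      ∪-clique {Y′} Y′⊆v = ⊆cluster⇒clique {v}
        (λ x∈ → [ Y⊆v , Y′⊆v ]′ (x∈p∪q⁻ Y Y′ x∈))
        (ℕ.≤-trans 2≤ (p⊆q⇒∣p∣≤∣q∣ (p⊆p∪q {p = Y} Y′)))

      child⊆v : ∀ {c} → Arc v c → cluster c ⊆ cluster v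
      child⊆v vc x∈ = ∈-cluster⁺ (vc ◅ ∈-cluster⁻ x∈)

      v⊆Y : ∀ {x} → v ≽ inj₁ x → x ∈ Y
      v⊆Y {x} (_◅_ {j = b} vb b≽x) with x ∈? Y
      ... | yes x∈Y = x∈Y
      ... | no  x∉Y with first-arc vb (∈-cluster⁻ (Y⊆v y₀∈Y)) | strong _ (cluster-module _) (∪-clique (child⊆v vb))
      ...   | _            | inj₁ ∩≡Y         = ⊥-elim (low b vb (∩≡ˡ⇒⊆ ∩≡Y))
      ...   | _            | inj₂ (inj₁ ∩≡Cb) = ∩≡ʳ⇒⊆ ∩≡Cb (∈-cluster⁺ b≽x)
      ...   | a , va , a≽y₀ | inj₂ (inj₂ ∩≡∅) = ⊥-elim overlapping
        where
        a≢b : a ≢ b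
        a≢b refl = ∩≡⊥⇒disjoint ∩≡∅ y₀∈Y (∈-cluster⁺ a≽y₀)

        agree : ∀ {x y z} → a ≽ inj₁ x → b ≽ inj₁ y → v ≽ inj₁ z → ¬ a ≽ inj₁ z → ¬ b ≽ inj₁ z → d x z ≡ d y z
        agree a≽x b≽y v≽z ¬a≽z ¬b≽z =
          let c , vc , c≽z = first-arc va v≽z
          in trans (d-split (a , c , va , vc , separates ¬a≽z c≽z , a≽x , c≽z))
                   (sym (d-split (b , c , vb , vc , separates ¬b≽z c≽z , b≽y , c≽z)))

        overlapping : ⊥
        overlapping with strong (cluster a ∪ cluster b)
                       (union-module (va ◅ ε) (vb ◅ ε) (λ a≽x b≽x → a≢b (children-disjoint va vb a≽x b≽x)) agree)
                       (∪-clique (λ x∈ → [ child⊆v va , child⊆v vb ]′ (x∈p∪q⁻ _ _ x∈)))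
        ... | inj₁ ∩≡Y         = low a va λ y∈Y →
          [ (λ y∈a → y∈a) , (λ y∈b → contradiction y∈b (∩≡⊥⇒disjoint ∩≡∅ y∈Y)) ]′ (x∈p∪q⁻ _ _ (∩≡ˡ⇒⊆ ∩≡Y y∈Y))
        ... | inj₂ (inj₁ ∩≡Y′) = x∉Y (∩≡ʳ⇒⊆ ∩≡Y′ (x∈p∪q⁺ (inj₂ (∈-cluster⁺ b≽x))))
        ... | inj₂ (inj₂ ∩≡∅′) = ∩≡⊥⇒disjoint ∩≡∅′ y₀∈Y (x∈p∪q⁺ (inj₁ (∈-cluster⁺ a≽y₀)))

    -- An overlapping clique-module Y′ forces t v ≡ t w for the vertex w where some z ∈ Y′ - C(v)
    -- branches off the path to v, and then t v ≡ t u by comparing with a leaf of another child of u.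
    cluster-strong : ∀ {u v a b c} → Arc u v → indeg v ≡ 1 → Arc v a → Arc v b → a ≢ b →
                     Arc u c → c ≢ v → t u ≢ t v → IsStrong d (cluster v)
    cluster-strong {u} {v} {a} {b} {c} uv in1 va vb a≢b uc c≢v tu≢tv Y′ mod cl
      with ⊆-or-witness (cluster v) Y′ | ⊆-or-witness Y′ (cluster v) | nonempty? (cluster v ∩ Y′)
    ... | inj₁ ⊆Y′ | _        | _      = inj₁ (⊆⇒∩≡ˡ ⊆Y′)
    ... | inj₂ _   | inj₁ Y′⊆ | _      = inj₂ (inj₁ (⊆⇒∩≡ʳ Y′⊆))
    ... | inj₂ _   | inj₂ _   | no em  = inj₂ (inj₂ (Empty-unique em))
    ... | inj₂ (y , y∈v , y∉Y′) | inj₂ (z , z∈Y′ , z∉v) | yes (x , x∈) = ⊥-elim (absurd mod)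
      where
      x∈v : x ∈ cluster v
      x∈v = proj₁ (x∈p∩q⁻ _ _ x∈)

      x∈Y′ : x ∈ Y′
      x∈Y′ = proj₂ (x∈p∩q⁻ _ _ x∈)

      x≢z : x ≢ z
      x≢z refl = z∉v x∈v

      other-child : ∀ e → ∃[ f ] (Arc v f × f ≢ e)
      other-child e with a ≟ e
      ... | yes refl = b , vb , a≢b ∘ sym
      ... | no a≢e   = a , va , a≢e

      separated : ∃₂ λ x y → x ∈ Y′ × y ∉ Y′ × Split v (inj₁ x) (inj₁ y)
      separated with first-arc va (∈-cluster⁻ x∈v) | first-arc va (∈-cluster⁻ y∈v)
      ... | e , ve , e≽x | f , vf , f≽y with e ≟ f
      ...   | no e≢f = x , y , x∈Y′ , y∉Y′ , e , f , ve , vf , e≢f , e≽x , f≽y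
      ...   | yes refl with other-child e
      ...     | g , vg , g≢e with leaf-below g
      ...       | s , g≽s with s ∈? Y′
      ...         | yes s∈Y′ = s , y , s∈Y′ , y∉Y′ , g , e , vg , vf , g≢e , g≽s , f≽y
      ...         | no  s∉Y′ = x , s , x∈Y′ , s∉Y′ , e , g , ve , vg , g≢e ∘ sym , e≽x , g≽s

      u-above : ∃[ r ] (r ≽ u × r ≽ inj₁ z)
      u-above with clique⇒⊆cluster cl
      ... | r , ⊆r with leaf-below a | leaf-below b
      ...   | α , a≽α | β , b≽β = r , r≽u , r≽z
        where
        r≽ : ∀ {s} → v ≽ inj₁ s → r ≽ inj₁ s
        r≽ v≽s = ∈-cluster⁻ (⊆r (x∈p∪q⁺ (inj₁ (∈-cluster⁺ v≽s))))

        r≽z : r ≽ inj₁ z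
        r≽z = ∈-cluster⁻ (⊆r (x∈p∪q⁺ (inj₂ z∈Y′)))

        r≢v : r ≢ v
        r≢v r≡v = z∉v (∈-cluster⁺ (subst (_≽ inj₁ z) r≡v r≽z))

        r≽u : r ≽ u
        r≽u with last-arc (branch va vb a≢b a≽α b≽β (r≽ (va ◅ a≽α)) (r≽ (vb ◅ b≽β))) r≢v
        ... | q , r≽q , qv with refl ← unique-parent in1 qv uv = r≽q

      branching : Split u v (inj₁ z) ⊎ ∃[ w ] Split w u (inj₁ z)
      branching with u-above
      ... | r , r≽ with lowest (λ w → (w ≽? u) ×-dec (w ≽? inj₁ z)) r r≽
      ...   | w , _ , (ε , u≽z) , _ =
        let f , uf , f≽z = first-arc uv u≽z
        in inj₁ (v , f , uv , uf , separates (z∉v ∘ ∈-cluster⁺) f≽z , ε , f≽z)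
      ...   | w , _ , (we ◅ e≽u , w≽z) , low =
        let f , wf , f≽z = first-arc we w≽z
        in inj₂ (w , _ , f , we , wf , separates (λ e≽z → low _ we (e≽u , e≽z)) f≽z , e≽u , f≽z)

      absurd : IsCliqueModule d Y′ → ⊥
      absurd (_ , inj₁ ∣Y′∣≡1) = ℕ.<⇒≢ (two≤∣ Y′ ∣ x∈Y′ z∈Y′ x≢z) (sym ∣Y′∣≡1)
      absurd (_ , inj₂ (_ , two-valued)) with separated
      ... | x₁ , y₁ , x₁∈Y′ , y₁∉Y′ , sv = by-branching branching
        where
        labels-agree : ∀ {p q r s z′} → r ∈ Y′ → s ∈ Y′ → z′ ∉ Y′ →
                       Split p (inj₁ r) (inj₁ z′) → Split q (inj₁ s) (inj₁ z′) → t p ≡ t q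
        labels-agree r∈ s∈ z′∉ sp sq with two-valued _ _ _ r∈ s∈ z′∉
        ... | inj₁ eq        = just-injective (trans (sym (d-split sp)) (trans eq (d-split sq)))
        ... | inj₂ (inj₁ eq) = contradiction (trans (sym (d-split sp)) eq) λ ()
        ... | inj₂ (inj₂ eq) = contradiction (trans (sym (d-split sq)) eq) λ ()

        v≽x₁ = proj₁ (Split-≽ sv)
        v≽y₁ = proj₂ (Split-≽ sv)

        by-branching : Split u v (inj₁ z) ⊎ ∃[ w ] Split w u (inj₁ z) → ⊥
        by-branching (inj₁ su) =
          tu≢tv (sym (labels-agree x₁∈Y′ z∈Y′ y₁∉Y′ sv (Split-sym (Split-mono v≽y₁ ε su))))
        by-branching (inj₂ (w , sw)) with leaf-below c
        ... | γ , c≽γ with γ ∈? Y′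
        ...   | yes γ∈Y′ = tu≢tv (sym (labels-agree x₁∈Y′ γ∈Y′ y₁∉Y′ sv (c , v , uc , uv , c≢v , c≽γ , v≽y₁)))
        ...   | no  γ∉Y′ = tu≢tv (trans
          (labels-agree x₁∈Y′ z∈Y′ γ∉Y′ (v , c , uv , uc , c≢v ∘ sym , v≽x₁ , c≽γ) (Split-sym (Split-mono (uc ◅ c≽γ) ε sw)))
          (sym (labels-agree x₁∈Y′ z∈Y′ y₁∉Y′ sv (Split-sym (Split-mono (uv ◅ v≽y₁) ε sw)))))

    internal-arc : ∀ {u j} → Arc u (inj₂ j) → InternalArc u (inj₂ j)
    internal-arc {inj₁ x} uv = contradiction uv leaf-no-child
    internal-arc {inj₂ i} uv = uv , leaves-only i , leaves-only _

    other-child : ∀ {u v} → Arc u v → outdeg u ≢ 1 → ∃[ c ] (Arc u c × c ≢ v)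
    other-child {inj₁ x} uv ≢1 = contradiction uv leaf-no-child
    other-child {inj₂ i} {v} uv ≢1 with two-children (outdeg-internal i) ≢1
    ... | a , b , a≢b , ua , ub with a ≟ v
    ...   | yes refl = b , ub , a≢b ∘ sym
    ...   | no a≢v   = a , ua , a≢v

    indeg1-children : ∀ {j} → indeg (inj₂ j) ≡ 1 → ∃₂ λ a b → a ≢ b × Arc (inj₂ j) a × Arc (inj₂ j) b
    indeg1-children {j} in1 = two-children (outdeg-internal j) (λ out1 → no-deg11 _ (in1 , out1))

    cluster∈family : Discriminating N t → ∀ i → InFamily d (cluster (inj₂ i))
    cluster∈family (disc₁ , disc₂) i with indeg (inj₂ i) in eq
    ... | 0 = inj₁ (_ , [] , root-cluster-maximal eq , [] , refl , cluster-nonempty _)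
    ... | 1 =
      let u , uv              = countV≥1⁻ (λ u → arc u (inj₂ i)) (ℕ.≤-reflexive (sym eq))
          a , b , a≢b , va , vb = indeg1-children eq
          c , uc , c≢v        = other-child uv (disc₁ _ _ (internal-arc uv))
          α , a≽α = leaf-below a
          β , b≽β = leaf-below b
          2≤ = two≤∣ cluster (inj₂ i) ∣ (∈-cluster⁺ (va ◅ a≽α)) (∈-cluster⁺ (vb ◅ b≽β))
                 (Split-≢ (a , b , va , vb , a≢b , a≽α , b≽β) ∘ cong inj₁)
      in inj₂ (cluster-module _ ,
               cluster-strong uv eq va vb a≢b uc c≢v (disc₂ _ _ (internal-arc uv) eq) ,
               λ ∣C∣≡1 → ℕ.<⇒≢ 2≤ (sym ∣C∣≡1))
    ... | suc (suc _) with countV≥2⁻ (λ u → arc u (inj₂ i)) (subst (2 ≤_) (sym eq) (s≤s (s≤s z≤n)))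
    ...   | p , q , p≢q , pv , qv with root-above p | root-above q
    ...     | r , rt , r≽p | s , st , s≽q =
      inj₁ (cluster r , cluster s ∷ [] , root-cluster-maximal rt , root-cluster-maximal st ∷ [] ,
            ⊆-antisym
              (λ x∈ → x∈p∩q⁺ (∈-cluster⁺ (s≽q ◅◅ qv ◅ ∈-cluster⁻ x∈) , ∈-cluster⁺ (r≽p ◅◅ pv ◅ ∈-cluster⁻ x∈)))
              (λ x∈ → let x∈s , x∈r = x∈p∩q⁻ _ _ x∈
                      in ∈-cluster⁺ (merge pv qv p≢q r≽p s≽q (∈-cluster⁻ x∈r) (∈-cluster⁻ x∈s))) ,
            cluster-nonempty _)

    only-leaf : (∀ u v → InternalArc u v → outdeg u ≢ 1) → ∀ {i} → outdeg (inj₂ i) ≡ 1 →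
                ∃[ x ] (Arc (inj₂ i) (inj₁ x) × (∀ {y} → inj₂ i ≽ inj₁ y → x ≡ y))
    only-leaf disc {i} out1 with countV≥1⁻ (arc (inj₂ i)) (ℕ.≤-reflexive (sym out1))
    ... | inj₂ j , ij = contradiction out1 (disc _ _ (internal-arc ij))
    ... | inj₁ x , ix = x , ix , λ { (ic ◅ c≽y) → only (unique-child out1 ix ic) c≽y }
      where
      only : ∀ {c y} → inj₁ x ≡ c → c ≽ inj₁ y → x ≡ y
      only refl x≽y = Sum.inj₁-injective (leaf-≽ x≽y)

    one-leaf≢branching : (∀ u v → InternalArc u v → outdeg u ≢ 1) →
      ∀ {i j} → outdeg (inj₂ i) ≡ 1 → outdeg (inj₂ j) ≢ 1 → cluster (inj₂ i) ≢ cluster (inj₂ j)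
    one-leaf≢branching disc {i} {j} i≡1 j≢1 eq =
      let x , _ , only = only-leaf disc i≡1
          a , b , a≢b , ja , jb = two-children (outdeg-internal j) j≢1
          α , a≽α = leaf-below a
          β , b≽β = leaf-below b
          x≡ : ∀ {y} → inj₂ j ≽ inj₁ y → x ≡ y
          x≡ = λ j≽y → only (∈-cluster⁻ (subst (_ ∈_) (sym eq) (∈-cluster⁺ j≽y)))
      in Split-≢ (a , b , ja , jb , a≢b , a≽α , b≽β) (cong inj₁ (trans (sym (x≡ (ja ◅ a≽α))) (x≡ (jb ◅ b≽β))))

    cluster-distinct : (∀ u v → InternalArc u v → outdeg u ≢ 1) →
                       ∀ i j → cluster (inj₂ i) ≡ cluster (inj₂ j) → i ≡ j
    cluster-distinct disc i j eq with outdeg (inj₂ i) ℕ.≟ 1 | outdeg (inj₂ j) ℕ.≟ 1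
    ... | no i≢1  | no j≢1  = Sum.inj₂-injective
      (cluster-injective (outdeg-internal i) i≢1 (outdeg-internal j) j≢1 eq)
    ... | yes i≡1 | no j≢1  = contradiction eq (one-leaf≢branching disc i≡1 j≢1)
    ... | no i≢1  | yes j≡1 = contradiction (sym eq) (one-leaf≢branching disc j≡1 i≢1)
    ... | yes i≡1 | yes j≡1 with only-leaf disc i≡1 | only-leaf disc j≡1
    ...   | x , ix , _ | y , jy , only
      with refl ← only (∈-cluster⁻ (subst (x ∈_) eq (∈-cluster⁺ (ix ◅ ε)))) =
      Sum.inj₂-injective (unique-parent (proj₁ (leaves-X x)) ix jy)

    discriminating⇒bijection : Discriminating N t → ClusterBijection N d
    discriminating⇒bijection disc =
      (λ i → cluster (inj₂ i) , cluster-isClusterOf (inj₂ i) , cluster∈family disc i) ,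
      (λ i j Y Ci Cj → cluster-distinct (proj₁ disc) i j (trans (sym (isClusterOf⇒≡ Ci)) (isClusterOf⇒≡ Cj))) ,
      (λ Y → [ CK⇒cluster , M⇒cluster ]′)

    indeg1∉CK : ∀ {u j c} → Arc u (inj₂ j) → indeg (inj₂ j) ≡ 1 → Arc u c → c ≢ inj₂ j →
                ¬ InCK d (cluster (inj₂ j))
    indeg1∉CK {u} {j} {c} uv in1 uc c≢v ck with CK⇒roots ck | indeg1-children in1 | leaf-below c
    ... | r , rs , rts , to , from | a , b , a≢b , va , vb | γ , c≽γ with leaf-below a | leaf-below b
    ...   | α , a≽α | β , b≽β =
      c≢v (children-disjoint uc uv c≽γ (∈-cluster⁻ (from γ (All.zipWith above (rts , All.zip (to α α∈ , to β β∈))))))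
      where
      α∈ = ∈-cluster⁺ (va ◅ a≽α)
      β∈ = ∈-cluster⁺ (vb ◅ b≽β)

      above : ∀ {s} → indeg s ≡ 0 × s ≽ inj₁ α × s ≽ inj₁ β → s ≽ inj₁ γ
      above (st , s≽α , s≽β)
        with last-arc (branch va vb a≢b a≽α b≽β s≽α s≽β) (λ { refl → contradiction (trans (sym st) in1) λ () })
      ... | q , s≽q , qv with refl ← unique-parent in1 qv uv = s≽q ◅◅ uc ◅ c≽γ

    -- For a child a of v, C(a) ∪ C(c) is a clique-module overlapping C(v).
    same-label⇒¬strong : ∀ {u v a b c} → Arc u v → Arc v a → Arc v b → a ≢ b → Arc u c → c ≢ v →
                         t u ≡ t v → ¬ IsStrong d (cluster v)
    same-label⇒¬strong {u} {v} {a} {b} {c} uv va vb a≢b uc c≢v tu≡tv strong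
      with leaf-below a | leaf-below b | leaf-below c
    ... | α , a≽α | β , b≽β | γ , c≽γ = overlapping
      where
      disjoint : ∀ {x} → v ≽ x → ¬ c ≽ x
      disjoint v≽x c≽x = c≢v (children-disjoint uc uv c≽x v≽x)

      agree : ∀ {x y z} → a ≽ inj₁ x → c ≽ inj₁ y → u ≽ inj₁ z → ¬ a ≽ inj₁ z → ¬ c ≽ inj₁ z → d x z ≡ d y z
      agree {z = z} a≽x c≽y u≽z ¬a≽z ¬c≽z with v ≽? inj₁ z
      ... | yes v≽z =
        let e , ve , e≽z = first-arc va v≽z
        in trans (d-split (a , e , va , ve , separates ¬a≽z e≽z , a≽x , e≽z))
                 (trans (cong just (sym tu≡tv)) (sym (d-split (c , v , uc , uv , c≢v , c≽y , v≽z))))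
      ... | no ¬v≽z =
        let f , uf , f≽z = first-arc uv u≽z
        in trans (d-split (v , f , uv , uf , separates ¬v≽z f≽z , va ◅ a≽x , f≽z))
                 (sym (d-split (c , f , uc , uf , separates ¬c≽z f≽z , c≽y , f≽z)))

      Y′ : Subset n
      Y′ = cluster a ∪ cluster c

      ∪-clique : IsClique d (cluster v ∪ Y′)
      ∪-clique = ⊆cluster⇒clique {u}
        (λ x∈ → ∈-cluster⁺ ([ (λ x∈v → uv ◅ ∈-cluster⁻ x∈v) ,
                              (λ x∈Y′ → [ (λ x∈a → uv ◅ va ◅ ∈-cluster⁻ x∈a) , (λ x∈c → uc ◅ ∈-cluster⁻ x∈c) ]′
                                           (x∈p∪q⁻ _ _ x∈Y′)) ]′ (x∈p∪q⁻ _ _ x∈)))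
        (two≤∣ _ ∣ (x∈p∪q⁺ (inj₁ (∈-cluster⁺ (va ◅ a≽α)))) (x∈p∪q⁺ (inj₁ (∈-cluster⁺ (vb ◅ b≽β))))
          (Split-≢ (a , b , va , vb , a≢b , a≽α , b≽β) ∘ cong inj₁))

      overlapping : ⊥
      overlapping with strong Y′ (union-module (uv ◅ va ◅ ε) (uc ◅ ε) (λ a≽x → disjoint (va ◅ a≽x)) agree) ∪-clique
      ... | inj₁ ∩≡C =
        [ (λ β∈a → a≢b (children-disjoint va vb (∈-cluster⁻ β∈a) b≽β)) ,
          (λ β∈c → disjoint (vb ◅ b≽β) (∈-cluster⁻ β∈c)) ]′
        (x∈p∪q⁻ _ _ (∩≡ˡ⇒⊆ ∩≡C (∈-cluster⁺ (vb ◅ b≽β))))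
      ... | inj₂ (inj₁ ∩≡Y′) =
        disjoint (∈-cluster⁻ (∩≡ʳ⇒⊆ ∩≡Y′ (x∈p∪q⁺ (inj₂ (∈-cluster⁺ c≽γ))))) c≽γ
      ... | inj₂ (inj₂ ∩≡∅) =
        ∩≡⊥⇒disjoint ∩≡∅ (∈-cluster⁺ (va ◅ a≽α)) (x∈p∪q⁺ (inj₁ (∈-cluster⁺ a≽α)))

    bijection⇒discriminating : ClusterBijection N d → Discriminating N t
    bijection⇒discriminating (family , injective , _) = out≢1 , label≢
      where
      out≢1 : ∀ u v → InternalArc u v → outdeg u ≢ 1
      out≢1 (inj₁ x) v        (uv , _ , _)    _    = leaf-no-child uv
      out≢1 (inj₂ i) (inj₁ x) (_ , _ , ¬leaf) _    = ¬leaf (leaves-X x)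
      out≢1 (inj₂ i) (inj₂ j) (ij , _ , _)    out1 =
        arc⇒⋡ ij (subst (λ m → inj₂ j ≽ inj₂ m) (sym i≡j) ε)
        where
        same : IsClusterOf (inj₂ i) (cluster (inj₂ j))
        same x = mk⇔ (λ x∈ → ij ◅ ∈-cluster⁻ x∈)
          λ { (ic ◅ c≽x) → ∈-cluster⁺ (subst (_≽ inj₁ x) (unique-child out1 ic ij) c≽x) }

        i≡j : i ≡ j
        i≡j = injective i j (cluster (inj₂ j)) same (cluster-isClusterOf (inj₂ j))

      label≢ : ∀ u v → InternalArc u v → indeg v ≡ 1 → t u ≢ t v
      label≢ u (inj₁ x) (_ , _ , ¬leaf) in1 _ = ¬leaf (leaves-X x)
      label≢ u (inj₂ j) ia@(uv , _ , _) in1 tu≡tv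
        with indeg1-children in1 | other-child uv (out≢1 _ _ ia) | family j
      ... | a , b , a≢b , va , vb | c , uc , c≢v | Y , C , Y∈ with refl ← isClusterOf⇒≡ C | Y∈
      ...   | inj₁ ck               = indeg1∉CK uv in1 uc c≢v ck
      ...   | inj₂ (_ , strong , _) = same-label⇒¬strong uv va vb a≢b uc c≢v tu≡tv strong

theorem9p5 : {n k : ℕ} (M : Set) → M → 2 ≤ n →
    (N : ArborealNetwork n k) (t : Vtx n k → M) (d : Fin n → Fin n → Maybe M) →
    IsDistOf N t d →
    Discriminating N t ⇔ ClusterBijection N d
theorem9p5 M _ _ N t d dist = mk⇔ discriminating⇒bijection bijection⇒discriminating
  where open Network.Labelled N t d dist
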